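{- Let $D$ be a nonempty set and $\epsilon\subseteq D\times D$ a binary relation (write $\epsilon ab$ for $(a,b)\in\epsilon$) such that for all $a,b,c\in D$: $\epsilon ab\Rightarrow\epsilon aa$; $\epsilon ab\wedge\epsilon bc\Rightarrow\epsilon ac$; $\epsilon ab\wedge\epsilon bb\Rightarrow\epsilon ba$. Then $(D,\epsilon)$ satisfies, for all $a,b\in D$, $$\epsilon ab\iff\big(\exists x\in D\,(\epsilon xa\wedge\epsilon xb)\big)\wedge\big(\forall x,y\in D\,(\epsilon xa\wedge\epsilon ya\Rightarrow\epsilon xy)\big)$$ if and only if $D$ contains no singular name.
   Context: A model for $\mathbf{L_1}$ is a pair $(D,\epsilon)$ as in the hypothesis; it is a model for Leśniewski's ontology $\mathbf{L}$ if it satisfies the displayed equivalence (the axiom of $\mathbf{L}$) for all $a,b\in D$. An element $a\in D$ is an atom if $\epsilon aa$. An element $b\in D$ is a singular name if $b$ is not an atom (not $\epsilon bb$), there exists $a\in D$ with $\epsilon ab$, and for all $x,y\in D$, $\epsilon xb\wedge\epsilon yb$ implies $\epsilon xy$. -}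

module Defs where

open import Data.Product using (∃; _×_)
open import Function.Bundles using (_⇔_)
open import Level using (Level; _⊔_)
open import Relation.Binary.Core using (Rel)
open import Relation.Nullary using (¬_)

private
  variable
    d ℓ : Level

record IsL₁Model (D : Set d) (ε : Rel D ℓ) : Set (d ⊔ ℓ) where
  field
    nonempty : D
    ε-refl   : ∀ {a b} → ε a b → ε a a
    ε-trans  : ∀ {a b c} → ε a b → ε b c → ε a c
    ε-sym    : ∀ {a b} → ε a b → ε b b → ε b a

LAxiom : (D : Set d) → Rel D ℓ → Set (d ⊔ ℓ)
LAxiom D ε = ∀ (a b : D) →
  ε a b ⇔ ((∃ λ x → ε x a × ε x b) × (∀ x y → ε x a × ε y a → ε x y))

IsAtom : {D : Set d} → Rel D ℓ → D → Set ℓ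
IsAtom ε a = ε a a

IsSingularName : {D : Set d} → Rel D ℓ → D → Set (d ⊔ ℓ)
IsSingularName ε b =
  ¬ IsAtom ε b × (∃ λ a → ε a b) × (∀ x y → ε x b × ε y b → ε x y)

{-# OPTIONS --safe #-}
module Submission where

open import Axiom.ExcludedMiddle using (ExcludedMiddle)
open import Data.Product using (∃; _×_; _,_)
open import Function.Bundles using (_⇔_; mk⇔; Equivalence)
open import Level using (Level)
open import Relation.Binary.Core using (Rel)
open import Relation.Nullary using (¬_)
open import Relation.Nullary.Decidable using (decidable-stable)
open import Defs

-- The axiom of L, taken at (b , b), says that a nonempty name whose members are
-- pairwise ε-related is an atom, so singular names cannot exist. Conversely, in
-- an L₁-model only the right-to-left half of the axiom can fail; if its subject
-- a is an atom then x ε a gives a ε x, hence a ε b, and otherwise a is a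
-- singular name.

LAxiom⇒noSingularName : ∀ {d ℓ} {D : Set d} {ε : Rel D ℓ} →
  LAxiom D ε → ¬ (∃ λ b → IsSingularName ε b)
LAxiom⇒noSingularName ax (b , ¬bb , (a , ab) , uniq) =
  -- With both arguments equal to `b`, the one member `a` fills both halves of the common-member
  -- clause.
  ¬bb (Equivalence.from (ax b b) ((a , ab , ab) , uniq))

module _ {d ℓ} {D : Set d} {ε : Rel D ℓ} (model : IsL₁Model D ε) where
  open IsL₁Model model

  -- Symmetry at the atom reverses `ε y a` to `ε a y`, so `a` links `x` to `y`.
  atom-members-related : ∀ {a} → IsAtom ε a → ∀ x y → ε x a × ε y a → ε x y
  atom-members-related aa x y (xa , ya) = ε-trans xa (ε-sym ya aa)

  atom-ε : ∀ {a b} → IsAtom ε a → (∃ λ x → ε x a × ε x b) → ε a b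
  atom-ε aa (x , xa , xb) = ε-trans (ε-sym xa aa) xb

  noSingularName⇒LAxiom : ExcludedMiddle ℓ →
    ¬ (∃ λ b → IsSingularName ε b) → LAxiom D ε
  noSingularName⇒LAxiom em none a b = mk⇔
    (λ ab → (a , ε-refl ab , ab) , atom-members-related (ε-refl ab))
    λ { (common@(x , xa , _) , uniq) → atom-ε
          -- Classical step: the common member `x` shows `a` nonempty, so a non-atom `a` would be
          -- singular; this yields only a double negation, which `em` removes.
          (decidable-stable em λ ¬aa → none (a , ¬aa , (x , xa) , uniq))
          common }

theorem5p2 : {d ℓ : Level} → ExcludedMiddle ℓ →
    (D : Set d) (ε : Rel D ℓ) → IsL₁Model D ε →
    LAxiom D ε ⇔ (¬ (∃ λ (b : D) → IsSingularName ε b))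
theorem5p2 em D ε model =
  mk⇔ LAxiom⇒noSingularName (noSingularName⇒LAxiom model em)
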